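{- Let $k\ge2$ be even, $\alpha_1,\dots,\alpha_k$ positive integers, and $G=C(\alpha_1,\dots,\alpha_k)$. Then the clique number of $G$ is $$\omega(G)=\max_{1\le i\le k/2}\Big\{\alpha_{2i-1}+\Big(\frac{k}{2}-i+1\Big)\Big\}.$$
   Context: $C(\alpha_1,\dots,\alpha_k)$ is defined recursively by $C(\alpha_1)=\overline{K_{\alpha_1}}$ (edgeless graph) and $C(\alpha_1,\dots,\alpha_i)=\overline{C(\alpha_1,\dots,\alpha_{i-1})\cup K_{\alpha_i}}$ for $i=2,\dots,k$ (disjoint union, then complement). Equivalently for $k$ even, with $\pi_i$ the $\alpha_i$ vertices introduced at step $i$: $\pi_i$ is a clique for $i$ odd, independent for $i$ even, and for $i<j$ vertices of $\pi_i,\pi_j$ are adjacent iff $j$ is even. $\omega(G)$ is the maximum size of a clique in $G$. -}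

module Defs where

open import Data.Fin using (Fin; toℕ; fromℕ<; splitAt)
open import Data.Fin.Properties using (_≟_; toℕ<n)
open import Data.Fin.Subset using (Subset; _∈_; ∣_∣)
open import Data.Nat using (ℕ; zero; suc; _+_; _*_; _<_; _≤_; _⊔_)
open import Data.Nat.DivMod using (_/_; m/n*n≤m)
open import Data.Nat.Properties using (*-monoˡ-<; <-≤-trans)
open import Data.Product using (_×_; _,_; ∃-syntax)
open import Data.Sum.Relation.Binary.Pointwise using (Pointwise; inj₁; inj₂; ⊎-symmetric; ⊎-decidable)
open import Data.Vec.Functional using (Vector; init; last; foldr)
open import Relation.Binary.Definitions using (Symmetric; Decidable)
open import Relation.Binary.PropositionalEquality using (_≡_; _≢_; refl; ≢-sym)
open import Relation.Nullary using (¬_; ¬?; _×-dec_)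

-- Finite simple graphs. Decidability of adjacency is the constructive form of
-- the edge set being an honest subset of the finite set of vertex pairs.
record Graph : Set₁ where
  field
    order  : ℕ
    Adj    : Fin order → Fin order → Set
    sym    : Symmetric Adj
    irrefl : ∀ {x} → ¬ Adj x x
    adj?   : Decidable Adj

open Graph public using (order; Adj)

K : ℕ → Graph
K n = record
  { order  = n
  ; Adj    = _≢_
  ; sym    = ≢-sym
  ; irrefl = λ x≢x → x≢x refl
  ; adj?   = λ x y → ¬? (x ≟ y)
  }

complement : Graph → Graph
complement G = record
  { order  = order G
  ; Adj    = λ x y → x ≢ y × ¬ Adj G x y
  ; sym    = λ (x≢y , ¬xy) → ≢-sym x≢y , λ yx → ¬xy (Graph.sym G yx)
  ; irrefl = λ (x≢x , _) → x≢x refl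
  ; adj?   = λ x y → ¬? (x ≟ y) ×-dec ¬? (Graph.adj? G x y)
  }

-- Disjoint union: the first `order G` vertices are those of G, the remaining
-- ones those of H; `Pointwise` never relates an inj₁ to an inj₂.
infixl 6 _∪_
_∪_ : Graph → Graph → Graph
G ∪ H = record
  { order  = order G + order H
  ; Adj    = λ x y → R (splitAt (order G) x) (splitAt (order G) y)
  ; sym    = ⊎-symmetric (Graph.sym G) (Graph.sym H)
  ; irrefl = R-irrefl
  ; adj?   = λ x y → ⊎-decidable (Graph.adj? G) (Graph.adj? H) (splitAt (order G) x) (splitAt (order G) y)
  }
  where
  R = Pointwise (Adj G) (Adj H)

  R-irrefl : ∀ {s} → ¬ R s s
  R-irrefl (inj₁ e) = Graph.irrefl G e
  R-irrefl (inj₂ e) = Graph.irrefl H e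

-- C(α₁,…,αₖ); the recursion peels off the last entry. The value at k = 0 is a
-- convention (the empty graph).
C : ∀ {k} → Vector ℕ k → Graph
C {zero}        α = K 0
C {suc zero}    α = complement (K (last α))
C {suc (suc k)} α = complement (C (init α) ∪ K (last α))

IsClique : (G : Graph) → Subset (order G) → Set
IsClique G S = ∀ {x y} → x ∈ S → y ∈ S → x ≢ y → Adj G x y

-- m = ω(G): some clique has m vertices and no clique has more.
IsCliqueNumber : Graph → ℕ → Set
IsCliqueNumber G m =
  (∃[ S ] (IsClique G S × ∣ S ∣ ≡ m)) ×
  (∀ S → IsClique G S → ∣ S ∣ ≤ m)

-- Maximum of a nonempty family of naturals (0 is neutral for _⊔_).
maximum : ∀ {n} → Vector ℕ n → ℕ
maximum = foldr _⊔_ 0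

-- Indices are 0-based: i : Fin (k / 2) stands for the 1-based index suc (toℕ i),
-- and position 2(suc (toℕ i)) − 1 is the 0-based position 2 · toℕ i.
oddPosition : ∀ {k} → Fin (k / 2) → Fin k
oddPosition {k} i = fromℕ< {toℕ i * 2} (<-≤-trans (*-monoˡ-< 2 (toℕ<n i)) (m/n*n≤m k 2))

{-# OPTIONS --safe #-}
-- Write ω for the clique number.  Peeling off the last two parts gives
--   C(α₁,…,αₖ₊₂) = complement (complement (C(α₁,…,αₖ) ∪ K αₖ₊₁) ∪ K αₖ₊₂),
-- the join of C(α₁,…,αₖ) ∪ K αₖ₊₁ with an independent set.  As ω is the maximum
-- over a disjoint union and additive over a join,
--   ω(C(α₁,…,αₖ₊₂)) = (ω(C(α₁,…,αₖ)) ⊔ αₖ₊₁) + 1,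
-- and the closed formula satisfies the same recursion.
module Submission where

open import Defs
open import Data.Bool using (true; false)
open import Data.Fin using (Fin; zero; suc; toℕ; fromℕ; fromℕ<; inject₁; splitAt; _↑ˡ_; _↑ʳ_)
open import Data.Fin.Properties using (_≟_; splitAt-↑ˡ; splitAt-↑ʳ; ↑ˡ-injective; ↑ʳ-injective; toℕ<n; toℕ-injective; toℕ-fromℕ; toℕ-fromℕ<; toℕ-inject₁)
open import Data.Fin.Subset using (Subset; _∈_; ∣_∣; ⊤; ⊥; ⁅_⁆)
open import Data.Fin.Subset.Properties using (∣⊤∣≡n; ∣⊥∣≡0; ∣p∣≤n; ∣⁅x⁆∣≡1; ∉⊥; x∈⁅x⁆; x∈⁅y⁆⇒x≡y; nonempty?; Empty-unique; p⊆q⇒∣p∣≤∣q∣)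
open import Data.Nat using (ℕ; zero; suc; _+_; _*_; _∸_; _⊔_; _≤_; _<_; z≤n; s≤s)
open import Data.Nat.DivMod using (_/_; m/n*n≡m)
open import Data.Nat.Divisibility using (_∣_)
open import Data.Nat.Properties using (≤-reflexive; ≤-trans; +-mono-≤; +-identityʳ; +-assoc; +-comm; +-distribʳ-⊔; ⊔-assoc; ⊔-identityʳ; ⊔-sel; m≤m⊔n; m≤n⊔m; n≤0⇒n≡0; *-monoˡ-<; n∸n≡0)
open import Data.Product using (_×_; _,_; ∃-syntax)
open import Data.Sum using (_⊎_; inj₁; inj₂)
import Data.Sum.Relation.Binary.Pointwise as ⊎
open import Data.Vec using ([]; _∷_; _++_; here; there) renaming (splitAt to splitVec)
open import Data.Vec.Functional using (Vector; init; last)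
open import Function using (_∘_)
open import Relation.Binary.PropositionalEquality using (_≡_; _≢_; refl; sym; trans; cong; cong₂; subst; module ≡-Reasoning)
open import Relation.Nullary using (¬_; yes; no; contradiction)
open import Relation.Nullary.Decidable using (decidable-stable)

-- Subsets of a vertex set split in two.

∣++∣ : ∀ {m n} (A : Subset m) (B : Subset n) → ∣ A ++ B ∣ ≡ ∣ A ∣ + ∣ B ∣
∣++∣ []          B = refl
∣++∣ (true  ∷ A) B = cong suc (∣++∣ A B)
∣++∣ (false ∷ A) B = ∣++∣ A B

∈-++⁺ˡ : ∀ {m n} {A : Subset m} {B : Subset n} {i} → i ∈ A → i ↑ˡ n ∈ A ++ B
∈-++⁺ˡ here      = here
∈-++⁺ˡ (there p) = there (∈-++⁺ˡ p)

∈-++⁺ʳ : ∀ {m n} (A : Subset m) {B : Subset n} {j} → j ∈ B → m ↑ʳ j ∈ A ++ B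
∈-++⁺ʳ []      p = p
∈-++⁺ʳ (_ ∷ A) p = there (∈-++⁺ʳ A p)

∈-++⁻ : ∀ {m n} (A : Subset m) {B : Subset n} {x} → x ∈ A ++ B →
  (∃[ i ] (x ≡ i ↑ˡ n × i ∈ A)) ⊎ (∃[ j ] (x ≡ m ↑ʳ j × j ∈ B))
∈-++⁻ []      p    = inj₂ (_ , refl , p)
∈-++⁻ (_ ∷ A) here = inj₁ (zero , refl , here)
∈-++⁻ (_ ∷ A) (there p) with ∈-++⁻ A p
... | inj₁ (i , refl , q) = inj₁ (suc i , refl , there q)
... | inj₂ (j , refl , q) = inj₂ (j , refl , q)

-- Cliques in disjoint unions and in joins.

module _ (G H : Graph) where
  private
    m = order G
    n = order H

  -- Adjacency in `G ∪ H` is stuck on `splitAt`; rewriting with its values on `_↑ˡ_` and `_↑ʳ_` lets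
  -- `Pointwise` see which sides the vertices come from.
  ∪-adj⁺ˡ : ∀ {x y} → Adj G x y → Adj (G ∪ H) (x ↑ˡ n) (y ↑ˡ n)
  ∪-adj⁺ˡ {x} {y} e rewrite splitAt-↑ˡ m x n | splitAt-↑ˡ m y n = ⊎.inj₁ e

  ∪-adj⁺ʳ : ∀ {x y} → Adj H x y → Adj (G ∪ H) (m ↑ʳ x) (m ↑ʳ y)
  ∪-adj⁺ʳ {x} {y} e rewrite splitAt-↑ʳ m n x | splitAt-↑ʳ m n y = ⊎.inj₂ e

  ∪-adj⁻ˡ : ∀ {x y} → Adj (G ∪ H) (x ↑ˡ n) (y ↑ˡ n) → Adj G x y
  ∪-adj⁻ˡ {x} {y} e rewrite splitAt-↑ˡ m x n | splitAt-↑ˡ m y n with ⊎.inj₁ e′ ← e = e′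

  ∪-adj⁻ʳ : ∀ {x y} → Adj (G ∪ H) (m ↑ʳ x) (m ↑ʳ y) → Adj H x y
  ∪-adj⁻ʳ {x} {y} e rewrite splitAt-↑ʳ m n x | splitAt-↑ʳ m n y with ⊎.inj₂ e′ ← e = e′

  ∪-¬adj : ∀ {x y} → ¬ Adj (G ∪ H) (x ↑ˡ n) (m ↑ʳ y)
  ∪-¬adj {x} {y} e rewrite splitAt-↑ˡ m x n | splitAt-↑ʳ m n y with () ← e

  ↑ˡ≢↑ʳ : ∀ {x y} → x ↑ˡ n ≢ m ↑ʳ y
  ↑ˡ≢↑ʳ {x} {y} eq with () ← trans (sym (splitAt-↑ˡ m x n)) (trans (cong (splitAt m) eq) (splitAt-↑ʳ m n y))

  module _ {A : Subset m} {B : Subset n} where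

    ∪-clique⁻ˡ : IsClique (G ∪ H) (A ++ B) → IsClique G A
    ∪-clique⁻ˡ c p q x≢y = ∪-adj⁻ˡ (c (∈-++⁺ˡ p) (∈-++⁺ˡ q) (x≢y ∘ ↑ˡ-injective n _ _))

    ∪-clique⁻ʳ : IsClique (G ∪ H) (A ++ B) → IsClique H B
    ∪-clique⁻ʳ c p q x≢y = ∪-adj⁻ʳ (c (∈-++⁺ʳ A p) (∈-++⁺ʳ A q) (x≢y ∘ ↑ʳ-injective m _ _))

    -- A vertex on each side would force an edge across, and there is none. Hence the clique number
    -- of a union is a maximum and not a sum.
    ∪-clique-onesided : IsClique (G ∪ H) (A ++ B) → A ≡ ⊥ ⊎ B ≡ ⊥
    ∪-clique-onesided c with nonempty? A | nonempty? B
    ... | no A∅       | _           = inj₁ (Empty-unique A∅)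
    ... | yes _       | no B∅       = inj₂ (Empty-unique B∅)
    ... | yes (_ , p) | yes (_ , q) = contradiction (c (∈-++⁺ˡ p) (∈-++⁺ʳ A q) ↑ˡ≢↑ʳ) ∪-¬adj

    join-clique⁻ˡ : IsClique (complement (G ∪ H)) (A ++ B) → IsClique (complement G) A
    join-clique⁻ˡ c p q x≢y with _ , ¬xy ← c (∈-++⁺ˡ p) (∈-++⁺ˡ q) (x≢y ∘ ↑ˡ-injective n _ _) =
      x≢y , ¬xy ∘ ∪-adj⁺ˡ

    join-clique⁻ʳ : IsClique (complement (G ∪ H)) (A ++ B) → IsClique (complement H) B
    join-clique⁻ʳ c p q x≢y with _ , ¬xy ← c (∈-++⁺ʳ A p) (∈-++⁺ʳ A q) (x≢y ∘ ↑ʳ-injective m _ _) =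
      x≢y , ¬xy ∘ ∪-adj⁺ʳ

    -- Vertices from different sides are never adjacent in `G ∪ H`, so they always are in its
    -- complement; only pairs within one side call on `a` or `b`.
    join-clique⁺ : IsClique (complement G) A → IsClique (complement H) B →
      IsClique (complement (G ∪ H)) (A ++ B)
    join-clique⁺ a b p q x≢y with ∈-++⁻ A p | ∈-++⁻ A q
    ... | inj₁ (_ , refl , p′) | inj₁ (_ , refl , q′) with _ , ¬xy ← a p′ q′ (x≢y ∘ cong (_↑ˡ n)) =
      x≢y , ¬xy ∘ ∪-adj⁻ˡ
    ... | inj₁ (_ , refl , _)  | inj₂ (_ , refl , _)  = x≢y , ∪-¬adj
    ... | inj₂ (_ , refl , _)  | inj₁ (_ , refl , _)  = x≢y , ∪-¬adj ∘ Graph.sym (G ∪ H)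
    ... | inj₂ (_ , refl , p′) | inj₂ (_ , refl , q′) with _ , ¬xy ← b p′ q′ (x≢y ∘ cong (m ↑ʳ_)) =
      x≢y , ¬xy ∘ ∪-adj⁻ʳ

  ∪-cliqueˡ : ∀ {A} → IsClique G A → IsClique (G ∪ H) (A ++ ⊥)
  ∪-cliqueˡ {A} a p q x≢y with ∈-++⁻ A p | ∈-++⁻ A q
  ... | inj₁ (_ , refl , p′) | inj₁ (_ , refl , q′) = ∪-adj⁺ˡ (a p′ q′ (x≢y ∘ cong (_↑ˡ n)))
  ... | inj₂ (_ , _ , p′)    | _                    = contradiction p′ ∉⊥
  ... | inj₁ _               | inj₂ (_ , _ , q′)    = contradiction q′ ∉⊥

  ∪-cliqueʳ : ∀ {B} → IsClique H B → IsClique (G ∪ H) (⊥ {m} ++ B)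
  ∪-cliqueʳ b p q x≢y with ∈-++⁻ (⊥ {m}) p | ∈-++⁻ (⊥ {m}) q
  ... | inj₂ (_ , refl , p′) | inj₂ (_ , refl , q′) = ∪-adj⁺ʳ (b p′ q′ (x≢y ∘ cong (m ↑ʳ_)))
  ... | inj₁ (_ , _ , p′)    | _                    = contradiction p′ ∉⊥
  ... | inj₂ _               | inj₁ (_ , _ , q′)    = contradiction q′ ∉⊥

  ∪-cliqueNumber : ∀ {a b} → IsCliqueNumber G a → IsCliqueNumber H b →
    IsCliqueNumber (G ∪ H) (a ⊔ b)
  ∪-cliqueNumber {a} {b} ((A , A-clique , ∣A∣≡a) , maxG) ((B , B-clique , ∣B∣≡b) , maxH) =
    attained , bound
    where
    ∣A++⊥∣ : ∀ (A : Subset m) → ∣ A ++ ⊥ {n} ∣ ≡ ∣ A ∣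
    ∣A++⊥∣ A = trans (∣++∣ A ⊥) (trans (cong (∣ A ∣ +_) (∣⊥∣≡0 n)) (+-identityʳ _))

    ∣⊥++B∣ : ∀ (B : Subset n) → ∣ ⊥ {m} ++ B ∣ ≡ ∣ B ∣
    ∣⊥++B∣ B = trans (∣++∣ (⊥ {m}) B) (cong (_+ ∣ B ∣) (∣⊥∣≡0 m))

    attained : ∃[ S ] (IsClique (G ∪ H) S × ∣ S ∣ ≡ a ⊔ b)
    -- The side attaining the maximum supplies the witness, padded with `⊥` on the other side.
    attained with ⊔-sel a b
    ... | inj₁ eq = A ++ ⊥ , ∪-cliqueˡ A-clique , trans (∣A++⊥∣ A) (trans ∣A∣≡a (sym eq))
    ... | inj₂ eq = ⊥ {m} ++ B , ∪-cliqueʳ B-clique , trans (∣⊥++B∣ B) (trans ∣B∣≡b (sym eq))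

    bound : ∀ S → IsClique (G ∪ H) S → ∣ S ∣ ≤ a ⊔ b
    bound S c with splitVec m S
    ... | S₁ , S₂ , refl with ∪-clique-onesided {S₁} {S₂} c
    ... | inj₁ refl = ≤-trans (≤-reflexive (∣⊥++B∣ S₂)) (≤-trans (maxH S₂ (∪-clique⁻ʳ c)) (m≤n⊔m a b))
    ... | inj₂ refl = ≤-trans (≤-reflexive (∣A++⊥∣ S₁)) (≤-trans (maxG S₁ (∪-clique⁻ˡ c)) (m≤m⊔n a b))

  -- `complement (G ∪ H)` is the join of `complement G` and `complement H`, hence the form of the
  -- hypotheses. The two halves of a clique can be chosen independently, so their sizes add.
  join-cliqueNumber : ∀ {a b} → IsCliqueNumber (complement G) a → IsCliqueNumber (complement H) b →
    IsCliqueNumber (complement (G ∪ H)) (a + b)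
  join-cliqueNumber {a} {b} ((A , A-clique , ∣A∣≡a) , maxG) ((B , B-clique , ∣B∣≡b) , maxH) =
    (A ++ B , join-clique⁺ A-clique B-clique , trans (∣++∣ A B) (cong₂ _+_ ∣A∣≡a ∣B∣≡b)) , bound
    where
    bound : ∀ S → IsClique (complement (G ∪ H)) S → ∣ S ∣ ≤ a + b
    bound S c with splitVec m S
    ... | S₁ , S₂ , refl = ≤-trans (≤-reflexive (∣++∣ S₁ S₂))
      (+-mono-≤ (maxG S₁ (join-clique⁻ˡ c)) (maxH S₂ (join-clique⁻ʳ {S₁} c)))

-- Double complements, complete graphs and edgeless graphs.

-- Needed because the left factor of the join is the complement of a graph that is itself a
-- complement. Adjacency comes back only doubly negated, and `adj?` removes the negations.
complement²-cliqueNumber : ∀ G {m} → IsCliqueNumber G m → IsCliqueNumber (complement (complement G)) m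
complement²-cliqueNumber G ((S , S-clique , ∣S∣≡m) , max) =
  (S , (λ p q x≢y → x≢y , λ (_ , ¬xy) → ¬xy (S-clique p q x≢y)) , ∣S∣≡m) ,
  λ T T-clique → max T λ p q x≢y → let _ , ¬¬xy = T-clique p q x≢y in
    decidable-stable (Graph.adj? G _ _) λ ¬xy → ¬¬xy (x≢y , ¬xy)

K-cliqueNumber : ∀ n → IsCliqueNumber (K n) n
K-cliqueNumber n = (⊤ , (λ _ _ x≢y → x≢y) , ∣⊤∣≡n n) , λ S _ → ∣p∣≤n S

independent-cliqueNumber : ∀ {n} → 0 < n → IsCliqueNumber (complement (K n)) 1
independent-cliqueNumber {suc n} _ =
  (⁅ zero ⁆ , singleton-clique , ∣⁅x⁆∣≡1 {suc n} zero) , bound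
  where
  singleton-clique : IsClique (complement (K (suc n))) ⁅ zero ⁆
  singleton-clique p q x≢y = contradiction (trans (x∈⁅y⁆⇒x≡y zero p) (sym (x∈⁅y⁆⇒x≡y zero q))) x≢y

  bound : ∀ S → IsClique (complement (K (suc n))) S → ∣ S ∣ ≤ 1
  bound S c with nonempty? S
  ... | no S∅ rewrite Empty-unique S∅ | ∣⊥∣≡0 n = z≤n
  ... | yes (x , x∈S) = ≤-trans (p⊆q⇒∣p∣≤∣q∣ S⊆⁅x⁆) (≤-reflexive (∣⁅x⁆∣≡1 x))
    where
    S⊆⁅x⁆ : ∀ {y} → y ∈ S → y ∈ ⁅ x ⁆
    S⊆⁅x⁆ {y} y∈S with y ≟ x
    ... | yes refl = x∈⁅x⁆ x
    -- Adjacency in `complement (K (suc n))` asserts both `y ≢ x` and its negation.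
    ... | no y≢x with _ , ¬y≢x ← c y∈S x∈S y≢x = contradiction y≢x ¬y≢x

-- The cases follow the clauses of `C`: a single part is `complement (K _)`, with no union with the
-- empty graph, so `k = 0` needs its own argument.
C-cliqueNumber-step : ∀ {k m} (α : Vector ℕ (suc (suc k))) → 0 < last α →
  IsCliqueNumber (C (init (init α))) m → IsCliqueNumber (C α) ((m ⊔ last (init α)) + 1)
C-cliqueNumber-step {zero} {m} α 0<last ((S , _ , ∣S∣≡m) , _)
  -- `C` of the empty vector has order 0, which forces `m` to be 0; then `0 ⊔ last (init α)`
  -- computes to `last (init α)`.
  rewrite n≤0⇒n≡0 (subst (_≤ 0) ∣S∣≡m (∣p∣≤n S)) =
  join-cliqueNumber (complement (K _)) (K _)
    (complement²-cliqueNumber (K _) (K-cliqueNumber _))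
    (independent-cliqueNumber 0<last)
C-cliqueNumber-step {suc k} α 0<last ω =
  join-cliqueNumber (complement (C (init (init α)) ∪ K _)) (K _)
    (complement²-cliqueNumber (C (init (init α)) ∪ K _)
      (∪-cliqueNumber (C (init (init α))) (K _) ω (K-cliqueNumber _)))
    (independent-cliqueNumber 0<last)

-- Maxima of finite families and the closed formula.

maximum-cong : ∀ {n} {f g : Vector ℕ n} → (∀ i → f i ≡ g i) → maximum f ≡ maximum g
maximum-cong {zero}  f≗g = refl
maximum-cong {suc n} f≗g = cong₂ _⊔_ (f≗g zero) (maximum-cong (f≗g ∘ suc))

-- `maximum` folds from the front while `C` peels from the back; associativity of `_⊔_` reconciles
-- the two.
maximum-init-last : ∀ {n} (f : Vector ℕ (suc n)) → maximum f ≡ maximum (init f) ⊔ last f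
maximum-init-last {zero}  f = ⊔-identityʳ (f zero)
maximum-init-last {suc n} f = trans
  (cong (f zero ⊔_) (maximum-init-last (f ∘ suc)))
  (sym (⊔-assoc (f zero) _ _))

-- The family is nonempty because the empty maximum is 0, which a shift by `c` would not preserve.
maximum-+ : ∀ {n} (f : Vector ℕ (suc n)) c → maximum (λ i → f i + c) ≡ maximum f + c
maximum-+ {zero}  f c = trans (⊔-identityʳ _) (cong (_+ c) (sym (⊔-identityʳ (f zero))))
maximum-+ {suc n} f c = trans
  (cong ((f zero + c) ⊔_) (maximum-+ (f ∘ suc) c))
  (sym (+-distribʳ-⊔ c (f zero) _))

-- The bound keeps the truncated subtraction exact.
n∸i≡n∸[1+i]+1 : ∀ {n i} → i < n → n ∸ i ≡ n ∸ suc i + 1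
n∸i≡n∸[1+i]+1 {suc n} {zero}  _         = +-comm 1 n
n∸i≡n∸[1+i]+1 {suc n} {suc i} (s≤s i<n) = n∸i≡n∸[1+i]+1 i<n

-- Abstracting over the position function avoids computing with k / 2.
C-cliqueNumber : ∀ q {k} → k ≡ q * 2 → (α : Vector ℕ k) → (∀ i → 0 < α i) →
  (pos : Fin q → Fin k) → (∀ i → toℕ (pos i) ≡ toℕ i * 2) →
  IsCliqueNumber (C α) (maximum (λ i → α (pos i) + (q ∸ suc (toℕ i) + 1)))
C-cliqueNumber zero    refl α α>0 pos pos≡ = K-cliqueNumber 0
-- Matching `refl` makes the length `suc (suc (q * 2))`, so two entries can be peeled off.
C-cliqueNumber (suc q) refl α α>0 pos pos≡ =
  subst (IsCliqueNumber (C α)) (sym recursion)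
    (C-cliqueNumber-step α (α>0 _)
      (C-cliqueNumber q refl α′ (λ i → α>0 _) pos′ (λ i → toℕ-fromℕ< (pos′< i))))
  where
  α′ : Vector ℕ (q * 2)
  α′ = init (init α)

  pos′< : (i : Fin q) → toℕ i * 2 < q * 2
  pos′< i = *-monoˡ-< 2 (toℕ<n i)

  pos′ : Fin q → Fin (q * 2)
  pos′ i = fromℕ< (pos′< i)

  -- `pos` is known only through `toℕ`, so positions are compared by their numerical values.
  pos-init : ∀ i → pos (inject₁ i) ≡ inject₁ (inject₁ (pos′ i))
  pos-init i = toℕ-injective (begin
    toℕ (pos (inject₁ i))               ≡⟨ pos≡ (inject₁ i) ⟩
    toℕ (inject₁ i) * 2                 ≡⟨ cong (_* 2) (toℕ-inject₁ i) ⟩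
    toℕ i * 2                           ≡⟨ toℕ-fromℕ< (pos′< i) ⟨
    toℕ (pos′ i)                        ≡⟨ toℕ-inject₁ (pos′ i) ⟨
    toℕ (inject₁ (pos′ i))              ≡⟨ toℕ-inject₁ (inject₁ (pos′ i)) ⟨
    toℕ (inject₁ (inject₁ (pos′ i)))    ∎)
    where open ≡-Reasoning

  pos-last : pos (fromℕ q) ≡ inject₁ (fromℕ (q * 2))
  pos-last = toℕ-injective (begin
    toℕ (pos (fromℕ q))               ≡⟨ pos≡ (fromℕ q) ⟩
    toℕ (fromℕ q) * 2                 ≡⟨ cong (_* 2) (toℕ-fromℕ q) ⟩
    q * 2                             ≡⟨ toℕ-fromℕ (q * 2) ⟨
    toℕ (fromℕ (q * 2))               ≡⟨ toℕ-inject₁ (fromℕ (q * 2)) ⟨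
    toℕ (inject₁ (fromℕ (q * 2)))     ∎)
    where open ≡-Reasoning

  -- The summand of the formula without its final `+ 1`; `suc q ∸ suc (toℕ i)` computes to
  -- `q ∸ toℕ i`. The removed 1 is the contribution of the last independent part.
  h : Vector ℕ (suc q)
  h i = α (pos i) + (q ∸ toℕ i)

  h-init : ∀ i → init h i ≡ α′ (pos′ i) + (q ∸ suc (toℕ i) + 1)
  h-init i = cong₂ _+_ (cong α (pos-init i))
    (trans (cong (q ∸_) (toℕ-inject₁ i)) (n∸i≡n∸[1+i]+1 (toℕ<n i)))

  -- At the top index `q` the offset `q ∸ q` vanishes, leaving the size of the newly added clique.
  h-last : last h ≡ last (init α)
  h-last = trans
    (cong₂ _+_ (cong α pos-last) (trans (cong (q ∸_) (toℕ-fromℕ q)) (n∸n≡0 q)))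
    (+-identityʳ _)

  recursion : maximum (λ i → α (pos i) + (q ∸ toℕ i + 1)) ≡
    (maximum (λ i → α′ (pos′ i) + (q ∸ suc (toℕ i) + 1)) ⊔ last (init α)) + 1
  recursion = begin
    maximum (λ i → α (pos i) + (q ∸ toℕ i + 1))  ≡⟨ maximum-cong (λ i → +-assoc (α (pos i)) (q ∸ toℕ i) 1) ⟨
    maximum (λ i → h i + 1)                      ≡⟨ maximum-+ h 1 ⟩
    maximum h + 1                                ≡⟨ cong (_+ 1) (maximum-init-last h) ⟩
    (maximum (init h) ⊔ last h) + 1              ≡⟨ cong (_+ 1) (cong₂ _⊔_ (maximum-cong h-init) h-last) ⟩
    (maximum (λ i → α′ (pos′ i) + (q ∸ suc (toℕ i) + 1)) ⊔ last (init α)) + 1  ∎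
    where open ≡-Reasoning

theorem5p1 : (k : ℕ) → 2 ≤ k → 2 ∣ k → (α : Vector ℕ k) → (∀ i → 0 < α i) →
    IsCliqueNumber (C α) (maximum (λ (i : Fin (k / 2)) → α (oddPosition i) + (k / 2 ∸ suc (toℕ i) + 1)))
theorem5p1 k _ 2∣k α α>0 =
  -- Evenness enters as `k ≡ k / 2 * 2`; the values of `oddPosition` are read off from its `fromℕ<`.
  C-cliqueNumber (k / 2) (sym (m/n*n≡m 2∣k)) α α>0 oddPosition (λ i → toℕ-fromℕ< _)
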